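{- Let $G$ be the graph constructed as follows. Take three vertex-disjoint copies $H_1,H_2,H_3$ of $K_2\vee\overline{K_2}$ ($K_4$ minus an edge). In each $H_i$ choose a vertex $v_i$ of degree $2$. Add a new vertex $u$ adjacent to $v_1,v_2,v_3$. Then $G$ is a graph with $\Delta(G)=3$ containing no odd cycle of length greater than $3$, and $G$ is not $3$-edge-orientable.
   Context: $G_1\vee G_2$ denotes the join: the disjoint union of $G_1$ and $G_2$ plus all edges between them. An orientation of a graph is any digraph obtained by replacing each edge $xy$ with the arc $(x,y)$, with the arc $(y,x)$, or with both arcs. A kernel of a digraph $D$ is an independent set $S$ such that every vertex of $D-S$ has an out-neighbor in $S$. $D$ is kernel-perfect if every induced subdigraph of $D$ has a kernel. A graph $G$ is $k$-edge-orientable if its line graph $L(G)$ admits a kernel-perfect orientation in which every vertex has out-degree at most $k-1$. -}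

module Defs where

open import Data.Bool.Base using (Bool; true; false; not; _∧_; _∨_; T)
open import Data.Bool.Properties using (∧-comm; ∨-comm)
open import Data.Empty using (⊥-elim)
open import Data.Fin.Base using (Fin; zero; suc; toℕ; splitAt; remQuot; combine)
open import Data.Fin.Properties using (_≟_; _<?_)
open import Data.Fin.Subset using (Subset; _∈_; _∉_; _∪_; ⁅_⁆; ∣_∣)
open import Data.List.Base using (List; length; lookup; filterᵇ; cartesianProduct; allFin)
open import Data.Nat.Base using (ℕ; suc; _+_; _*_; _≤_; _<_; _⊔_)
open import Data.Product.Base using (∃; _×_; _,_)
open import Data.Sum.Base using (_⊎_; inj₁; inj₂)
import Data.Vec.Base as Vec
import Data.Vec.Functional as Vector
open import Function.Bundles using (_↣_; Injection)
open import Relation.Binary.PropositionalEquality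
open import Relation.Nullary using (¬_; does; yes; no)

_==_ : ∀ {n} → Fin n → Fin n → Bool
x == y = does (x ≟ y)

==-refl : ∀ {n} (x : Fin n) → (x == x) ≡ true
==-refl x with x ≟ x
... | yes _  = refl
... | no x≢x = ⊥-elim (x≢x refl)

==-sym : ∀ {n} (x y : Fin n) → (x == y) ≡ (y == x)
==-sym x y with x ≟ y | y ≟ x
... | yes _   | yes _   = refl
... | no _    | no _    = refl
... | yes x≡y | no y≢x  = ⊥-elim (y≢x (sym x≡y))
... | no x≢y  | yes y≡x = ⊥-elim (x≢y (sym y≡x))

record Graph (n : ℕ) : Set where
  field
    adj        : Fin n → Fin n → Bool
    adj-sym    : ∀ x y → adj x y ≡ adj y x
    adj-irrefl : ∀ x → adj x x ≡ false

open Graph public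

degree : ∀ {n} → Graph n → Fin n → ℕ
degree G x = ∣ Vec.tabulate (adj G x) ∣

maxDegree : ∀ {n} → Graph n → ℕ
maxDegree G = Vector.foldr _⊔_ 0 (degree G)

complete : ∀ n → Graph n
complete n = record
  { adj        = λ x y → not (x == y)
  ; adj-sym    = λ x y → cong not (==-sym x y)
  ; adj-irrefl = λ x → cong not (==-refl x)
  }

complement : ∀ {n} → Graph n → Graph n
complement G = record
  { adj        = λ x y → not (x == y) ∧ not (adj G x y)
  ; adj-sym    = λ x y → cong₂ (λ a b → not a ∧ not b) (==-sym x y) (adj-sym G x y)
  ; adj-irrefl = λ x → cong (λ a → not a ∧ not (adj G x x)) (==-refl x)
  }

_∨ᴳ_ : ∀ {m n} → Graph m → Graph n → Graph (m + n)
_∨ᴳ_ {m} {n} G₁ G₂ = record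
  { adj        = λ x y → joinAdj (splitAt m x) (splitAt m y)
  ; adj-sym    = λ x y → joinAdj-sym (splitAt m x) (splitAt m y)
  ; adj-irrefl = λ x → joinAdj-irrefl (splitAt m x)
  }
  where
  joinAdj : Fin m ⊎ Fin n → Fin m ⊎ Fin n → Bool
  joinAdj (inj₁ x) (inj₁ y) = adj G₁ x y
  joinAdj (inj₂ x) (inj₂ y) = adj G₂ x y
  joinAdj (inj₁ _) (inj₂ _) = true
  joinAdj (inj₂ _) (inj₁ _) = true

  joinAdj-sym : ∀ x y → joinAdj x y ≡ joinAdj y x
  joinAdj-sym (inj₁ x) (inj₁ y) = adj-sym G₁ x y
  joinAdj-sym (inj₂ x) (inj₂ y) = adj-sym G₂ x y
  joinAdj-sym (inj₁ _) (inj₂ _) = refl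
  joinAdj-sym (inj₂ _) (inj₁ _) = refl

  joinAdj-irrefl : ∀ x → joinAdj x x ≡ false
  joinAdj-irrefl (inj₁ x) = adj-irrefl G₁ x
  joinAdj-irrefl (inj₂ x) = adj-irrefl G₂ x

-- The disjoint union of k copies of H; `combine i x` is vertex x of copy i.
copies : ∀ k {n} → Graph n → Graph (k * n)
copies k {n} H = record
  { adj        = λ x y → copyAdj (remQuot {k} n x) (remQuot {k} n y)
  ; adj-sym    = λ x y → copyAdj-sym (remQuot {k} n x) (remQuot {k} n y)
  ; adj-irrefl = λ x → copyAdj-irrefl (remQuot {k} n x)
  }
  where
  copyAdj : Fin k × Fin n → Fin k × Fin n → Bool
  copyAdj (i , x) (j , y) = (i == j) ∧ adj H x y

  copyAdj-sym : ∀ p q → copyAdj p q ≡ copyAdj q p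
  copyAdj-sym (i , x) (j , y) = cong₂ _∧_ (==-sym i j) (adj-sym H x y)

  copyAdj-irrefl : ∀ p → copyAdj p p ≡ false
  copyAdj-irrefl (i , x) = trans (∧-comm (i == i) _) (cong (_∧ (i == i)) (adj-irrefl H x))

-- The new vertex is `zero`, and the vertex x of G becomes `suc x`.
addVertex : ∀ {n} → Graph n → Subset n → Graph (suc n)
addVertex {n} G N = record
  { adj        = adj⁺
  ; adj-sym    = adj⁺-sym
  ; adj-irrefl = adj⁺-irrefl
  }
  where
  adj⁺ : Fin (suc n) → Fin (suc n) → Bool
  adj⁺ zero    zero    = false
  adj⁺ zero    (suc y) = Vec.lookup N y
  adj⁺ (suc x) zero    = Vec.lookup N x
  adj⁺ (suc x) (suc y) = adj G x y

  adj⁺-sym : ∀ x y → adj⁺ x y ≡ adj⁺ y x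
  adj⁺-sym zero    zero    = refl
  adj⁺-sym zero    (suc _) = refl
  adj⁺-sym (suc _) zero    = refl
  adj⁺-sym (suc x) (suc y) = adj-sym G x y

  adj⁺-irrefl : ∀ x → adj⁺ x x ≡ false
  adj⁺-irrefl zero    = refl
  adj⁺-irrefl (suc x) = adj-irrefl G x

-- A cycle of length ℓ, as a not necessarily induced subgraph.
record Cycle {n} (G : Graph n) (ℓ : ℕ) : Set where
  field
    length≥3 : 3 ≤ ℓ
    vertices : Fin ℓ ↣ Fin n
  vertex : Fin ℓ → Fin n
  vertex = Injection.to vertices
  field
    step  : ∀ i j → toℕ j ≡ suc (toℕ i) → T (adj G (vertex i) (vertex j))
    close : ∀ i j → suc (toℕ i) ≡ ℓ → toℕ j ≡ 0 → T (adj G (vertex i) (vertex j))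

-- Each edge is listed once, with its smaller endpoint first.
edges : ∀ {n} → Graph n → List (Fin n × Fin n)
edges {n} G =
  filterᵇ (λ (x , y) → does (x <? y) ∧ adj G x y) (cartesianProduct (allFin n) (allFin n))

shareEndpoint : ∀ {n} → Fin n × Fin n → Fin n × Fin n → Bool
shareEndpoint (a , b) (c , d) = ((a == c) ∨ (b == d)) ∨ ((a == d) ∨ (b == c))

shareEndpoint-sym : ∀ {n} (e f : Fin n × Fin n) → shareEndpoint e f ≡ shareEndpoint f e
shareEndpoint-sym (a , b) (c , d) = cong₂ _∨_
  (cong₂ _∨_ (==-sym a c) (==-sym b d))
  (trans (∨-comm (a == d) (b == c)) (cong₂ _∨_ (==-sym b c) (==-sym a d)))

-- Vertices of L(G) are positions in `edges G`; this list has no repetitions, so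
-- distinct positions are distinct edges.
lineGraph : ∀ {n} (G : Graph n) → Graph (length (edges G))
lineGraph G = record
  { adj        = λ e f → not (e == f) ∧ shareEndpoint (lookup (edges G) e) (lookup (edges G) f)
  ; adj-sym    = λ e f → cong₂ (λ a b → not a ∧ b) (==-sym e f)
                   (shareEndpoint-sym (lookup (edges G) e) (lookup (edges G) f))
  ; adj-irrefl = λ e → cong (λ a → not a ∧ shareEndpoint (lookup (edges G) e) (lookup (edges G) e))
                   (==-refl e)
  }

record Digraph (n : ℕ) : Set where
  field
    arc : Fin n → Fin n → Bool

open Digraph public

outDegree : ∀ {n} → Digraph n → Fin n → ℕ
outDegree D x = ∣ Vec.tabulate (arc D x) ∣

-- `edge⇒arc` is inclusive: both arcs may be present.
record IsOrientation {n} (D : Digraph n) (G : Graph n) : Set where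
  field
    arc⇒edge : ∀ x y → T (arc D x y) → T (adj G x y)
    edge⇒arc : ∀ x y → T (adj G x y) → T (arc D x y) ⊎ T (arc D y x)

record IsKernel {n} (D : Digraph n) (S : Subset n) : Set where
  field
    independent : ∀ x y → x ∈ S → y ∈ S → ¬ T (arc D x y)
    absorbing   : ∀ x → x ∉ S → ∃ λ y → y ∈ S × T (arc D x y)

HasKernel : ∀ {n} → Digraph n → Set
HasKernel D = ∃ λ S → IsKernel D S

-- The subdigraph of D induced by the image of the injection f, with vertex f i
-- named i.
induced : ∀ {m n} → Digraph n → Fin m ↣ Fin n → Digraph m
induced D f = record { arc = λ i j → arc D (Injection.to f i) (Injection.to f j) }

KernelPerfect : ∀ {n} → Digraph n → Set
KernelPerfect {n} D = ∀ {m} (f : Fin m ↣ Fin n) → HasKernel (induced D f)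

-- `_< k` is "at most k - 1" without truncated subtraction.
EdgeOrientable : ℕ → ∀ {n} → Graph n → Set
EdgeOrientable k G = ∃ λ D →
  IsOrientation D (lineGraph G) × KernelPerfect D × (∀ e → outDegree D e < k)

H : Graph 4
H = complete 2 ∨ᴳ complement (complete 2)

-- v₁, v₂, v₃ name the chosen vertices inside the three copies of H.
theGraph : (v₁ v₂ v₃ : Fin 4) → Graph (1 + 3 * 4)
theGraph v₁ v₂ v₃ = addVertex (copies 3 H)
  (⁅ combine {3} zero v₁ ⁆ ∪ ⁅ combine {3} (suc zero) v₂ ⁆ ∪ ⁅ combine {3} (suc (suc zero)) v₃ ⁆)

{-# OPTIONS --safe #-}

-- At the new vertex u all edges are bridges, so every cycle lies in one copy of K₄ - e
-- and has length at most 4.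
--
-- In a kernel-perfect orientation every triangle of L(G) has a vertex that receives arcs
-- from the two others. For the triangle of the three edges at u this gives an i such that
-- the edge uvᵢ has arcs to both other edges at u; having out-degree at most 2, it has no
-- arcs to the two edges pᵢvᵢ and qᵢvᵢ of Hᵢ, which therefore spend one of their own two
-- arcs on uvᵢ. The eight adjacencies inside L(Hᵢ) are then oriented with at most eight
-- arcs, and the resulting forced arcs leave a triangle without a sink.

module Submission where

open import Defs
open import Data.Bool.Base using (T)
open import Data.Bool.Properties using (T?; T-≡)
open import Data.Fin.Base using (Fin; zero; suc; toℕ; fromℕ<; remQuot; combine; punchIn; _↑ˡ_; _↑ʳ_)
open import Data.Fin.Patterns
open import Data.Fin.Properties
  using (_≟_; all?; injective⇒≤; punchInᵢ≢i; toℕ-fromℕ<; toℕ-injective; toℕ<n;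
         remQuot-combine; combine-remQuot)
open import Data.Fin.Subset using (Subset; _∈_; _∪_; ⁅_⁆; ∣_∣; _-_)
open import Data.Fin.Subset.Properties
  using (_∈?_; x∈p∧x≢y⇒x∈p-y; x∈p⇒∣p-x∣<∣p∣; x∈⁅y⁆⇒x≡y; x∈p∪q⁻)
open import Data.List.Base using (length)
open import Data.Nat.Base
  using (ℕ; zero; suc; _+_; _*_; _∸_; _≤_; _<_; _%_; z<s; s<s; s≤s; z≤n; NonZero)
open import Data.Nat.DivMod using (%-distribˡ-+; m%n%n≡m%n; m<n⇒m%n≡m; m%n<n; n%n≡0; [m+n]%n≡m%n)
open import Data.Nat.Properties
  using (≤-<-trans; ≤-refl; <⇒≱; ≤-antisym; m≤n⇒m<n∨m≡n; m+[n∸m]≡n;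
         +-comm; +-assoc; +-suc; +-identityʳ; <⇒≤; m≤n⇒m≤1+n)
open import Data.Product.Base using (∃; _×_; _,_; proj₁; proj₂)
open import Data.Sum.Base using (_⊎_; inj₁; inj₂; [_,_]′)
open import Data.Vec.Base using ([]; _∷_; lookup; tabulate)
open import Data.Vec.Properties using (lookup⇒[]=; lookup∘tabulate)
open import Function.Base using (_∘_)
open import Function.Bundles using (mk↣; Injection; Equivalence)
open import Function.Definitions using (Injective)
open import Relation.Binary.PropositionalEquality
  using (_≡_; _≢_; refl; sym; trans; cong; subst; subst₂; ≢-sym; module ≡-Reasoning)
open import Relation.Nullary using (¬_; Dec; yes; no; contradiction)
open import Relation.Nullary.Decidable using (True; False; toWitness; toWitnessFalse; _→-dec_; ¬?; _×-dec_)

-- Cycles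

-- Adding `ℓ ∸ i` modulo `ℓ` undoes the shift by `i`.
%-shift-injective : ∀ {ℓ} .{{_ : NonZero ℓ}} {i a b} → i < ℓ → a < ℓ → b < ℓ →
  (i + a) % ℓ ≡ (i + b) % ℓ → a ≡ b
%-shift-injective {ℓ} {i} {a} {b} i<ℓ a<ℓ b<ℓ eq = begin
  a                                ≡⟨ unshift a<ℓ ⟨
  ((i + a) % ℓ + (ℓ ∸ i) % ℓ) % ℓ  ≡⟨ cong (λ x → (x + (ℓ ∸ i) % ℓ) % ℓ) eq ⟩
  ((i + b) % ℓ + (ℓ ∸ i) % ℓ) % ℓ  ≡⟨ unshift b<ℓ ⟩
  b                                ∎
  where
  open ≡-Reasoning
  unshift : ∀ {c} → c < ℓ → ((i + c) % ℓ + (ℓ ∸ i) % ℓ) % ℓ ≡ c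
  unshift {c} c<ℓ = begin
    ((i + c) % ℓ + (ℓ ∸ i) % ℓ) % ℓ  ≡⟨ %-distribˡ-+ (i + c) (ℓ ∸ i) ℓ ⟨
    (i + c + (ℓ ∸ i)) % ℓ            ≡⟨ cong (λ x → (x + (ℓ ∸ i)) % ℓ) (+-comm i c) ⟩
    (c + i + (ℓ ∸ i)) % ℓ            ≡⟨ cong (_% ℓ) (+-assoc c i (ℓ ∸ i)) ⟩
    (c + (i + (ℓ ∸ i))) % ℓ          ≡⟨ cong (λ x → (c + x) % ℓ) (m+[n∸m]≡n (<⇒≤ i<ℓ)) ⟩
    (c + ℓ) % ℓ                      ≡⟨ [m+n]%n≡m%n c ℓ ⟩
    c % ℓ                            ≡⟨ m<n⇒m%n≡m c<ℓ ⟩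
    c                                ∎

-- The two cases match the fields `step` and `close` of a cycle: the residue either advances by one
-- or wraps around from `ℓ - 1` to 0.
%-suc : ∀ k ℓ .{{_ : NonZero ℓ}} →
  suc k % ℓ ≡ suc (k % ℓ) ⊎ (suc (k % ℓ) ≡ ℓ × suc k % ℓ ≡ 0)
%-suc k ℓ with m≤n⇒m<n∨m≡n (m%n<n k ℓ)
                 | trans (%-distribˡ-+ 1 (k % ℓ) ℓ)
                     (trans (cong (λ x → (1 % ℓ + x) % ℓ) (m%n%n≡m%n k ℓ))
                       (sym (%-distribˡ-+ 1 k ℓ)))
... | inj₁ 1+r<ℓ | reduce = inj₁ (trans (sym reduce) (m<n⇒m%n≡m 1+r<ℓ))
... | inj₂ 1+r≡ℓ | reduce =
  inj₂ (1+r≡ℓ , trans (sym reduce) (trans (cong (_% ℓ) 1+r≡ℓ) (n%n≡0 ℓ)))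

-- Unrolls the cycle into a walk on ℕ of period `ℓ`, so that it can be read from any starting vertex
-- without treating the closing edge separately.
module CyclicWalk {n ℓ} {G : Graph n} .{{_ : NonZero ℓ}} (C : Cycle G ℓ) where
  open Cycle C

  index : ℕ → Fin ℓ
  index k = fromℕ< (m%n<n k ℓ)

  toℕ-index : ∀ k → toℕ (index k) ≡ k % ℓ
  toℕ-index k = toℕ-fromℕ< (m%n<n k ℓ)

  walk : ℕ → Fin n
  walk k = vertex (index k)

  walk-step : ∀ k → T (adj G (walk k) (walk (suc k)))
  walk-step k with %-suc k ℓ
  ... | inj₁ next = step (index k) (index (suc k))
    (trans (toℕ-index (suc k)) (trans next (cong suc (sym (toℕ-index k)))))
  ... | inj₂ (last , first) = close (index k) (index (suc k))
    (trans (cong suc (toℕ-index k)) last) (trans (toℕ-index (suc k)) first)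

  walk-cong : ∀ j k → j % ℓ ≡ k % ℓ → walk j ≡ walk k
  walk-cong j k eq =
    cong vertex (toℕ-injective (trans (toℕ-index j) (trans eq (sym (toℕ-index k)))))

  walk-toℕ : ∀ i → walk (toℕ i) ≡ vertex i
  walk-toℕ i = cong vertex
    (toℕ-injective (trans (toℕ-index (toℕ i)) (m<n⇒m%n≡m (toℕ<n i))))

  walk-injective : ∀ {i a b} → i < ℓ → a < ℓ → b < ℓ →
    walk (i + a) ≡ walk (i + b) → a ≡ b
  walk-injective {i} {a} {b} i<ℓ a<ℓ b<ℓ eq = %-shift-injective i<ℓ a<ℓ b<ℓ
    (trans (sym (toℕ-index (i + a)))
      (trans (cong toℕ (Injection.injective vertices eq)) (toℕ-index (i + b))))

-- If every class of κ is a union of components of G and contains at most one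
-- neighbour of the new vertex, then all edges at the new vertex are bridges.
module BridgeVertex {n} {A : Set} (G : Graph n) (N : Subset n) (κ : Fin n → A)
  (κ-adj : ∀ x y → T (adj G x y) → κ x ≡ κ y)
  (κ-separates : ∀ x y → x ∈ N → y ∈ N → κ x ≡ κ y → x ≡ y) where

  -- As long as the walk avoids the new vertex, each of its steps is an edge of `G`, and `κ-adj`
  -- keeps the class constant.
  follow : ∀ (w : ℕ → Fin (suc n)) → (∀ k → T (adj (addVertex G N) (w k) (w (suc k)))) →
    ∀ m → (∀ k → k ≤ m → w k ≢ zero) → ∀ {x} → w 0 ≡ suc x →
    ∃ λ y → w m ≡ suc y × κ y ≡ κ x
  follow w steps zero    avoids {x} w₀ = x , w₀ , refl
  follow w steps (suc m) avoids {x} w₀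
    with follow w steps m (λ k k≤m → avoids k (m≤n⇒m≤1+n k≤m)) w₀
  ... | y , wₘ , κy≡κx with w (suc m) in eq | steps m
  ...   | zero  | _ = contradiction eq (avoids (suc m) ≤-refl)
  ...   | suc z | y~z rewrite wₘ = z , refl , trans (sym (κ-adj y z y~z)) κy≡κx

  nonzero : ∀ {m} (x : Fin (suc m)) → x ≢ zero → ∃ λ y → x ≡ suc y
  nonzero zero    x≢0 = contradiction refl x≢0
  nonzero (suc y) _   = y , refl

  neighbour : ∀ {y} → T (lookup N y) → y ∈ N
  neighbour {y} t = lookup⇒[]= y N (Equivalence.to T-≡ t)

  -- Otherwise the rest of the cycle joins the two cycle neighbours of the new vertex inside one
  -- class. Both lie in `N`, so `κ-separates` identifies them, although their positions 1 and
  -- `ℓ - 1` after the new vertex differ because `ℓ` is at least 3.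
  cycle-avoids : ∀ {ℓ} (C : Cycle (addVertex G N) ℓ) i → Cycle.vertex C i ≢ zero
  cycle-avoids C _ _ with Cycle.length≥3 C
  cycle-avoids {ℓ} C i vᵢ≡0 | s≤s (s≤s (s≤s {n = r} _)) =
    contradiction (walk-injective i<ℓ (s<s z<s) ≤-refl
      (trans first≡x (trans (cong suc x≡y) (sym last≡y)))) λ ()
    where
    open CyclicWalk C
    j = toℕ i

    i<ℓ : j < ℓ
    i<ℓ = toℕ<n i

    wⱼ≡0 : walk j ≡ zero
    wⱼ≡0 = trans (walk-toℕ i) vᵢ≡0

    -- The walk restarted just after the new vertex. As `ℓ` is `r + 3`, `w (suc r)` is the last
    -- vertex before the return.
    w : ℕ → Fin (suc n)
    w k = walk (j + suc k)

    steps : ∀ k → T (adj (addVertex G N) (w k) (w (suc k)))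
    steps k = subst (λ x → T (adj (addVertex G N) (w k) (walk x)))
      (sym (+-suc j (suc k))) (walk-step (j + suc k))

    avoids : ∀ k → k ≤ suc r → w k ≢ zero
    avoids k k≤1+r w≡0 = contradiction
      (walk-injective i<ℓ (s≤s (s≤s k≤1+r)) z<s
        (trans w≡0 (trans (sym wⱼ≡0) (cong walk (sym (+-identityʳ j)))))) λ ()

    first = nonzero (w 0) (avoids 0 z≤n)
    x = proj₁ first

    first≡x : w 0 ≡ suc x
    first≡x = proj₂ first

    last = follow w steps (suc r) avoids first≡x
    y = proj₁ last

    last≡y : w (suc r) ≡ suc y
    last≡y = proj₁ (proj₂ last)

    x∈N : x ∈ N
    x∈N = neighbour (subst₂ (λ a b → T (adj (addVertex G N) a b)) wⱼ≡0
      (trans (cong walk (+-comm 1 j)) first≡x) (walk-step j))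

    y∈N : y ∈ N
    y∈N = neighbour (subst₂ (λ a b → T (adj (addVertex G N) a b)) last≡y
      (trans (walk-cong (j + ℓ) j ([m+n]%n≡m%n j ℓ)) wⱼ≡0) (steps (suc r)))

    x≡y : x ≡ y
    x≡y = κ-separates x y x∈N y∈N (sym (proj₂ (proj₂ last)))

  cycle-in-one-class : ∀ {ℓ} (C : Cycle (addVertex G N) ℓ) → ∃ λ k →
    ∀ i → ∃ λ y → Cycle.vertex C i ≡ suc y × κ y ≡ k
  cycle-in-one-class C with Cycle.length≥3 C
  cycle-in-one-class C | s≤s _ = κ (proj₁ start) , in-class
    where
    open CyclicWalk C
    start = nonzero (walk 0) (cycle-avoids C (index 0))
    in-class : ∀ i → ∃ λ y → Cycle.vertex C i ≡ suc y × κ y ≡ κ (proj₁ start)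
    in-class i = subst (λ v → ∃ λ y → v ≡ suc y × κ y ≡ κ (proj₁ start)) (walk-toℕ i)
      (follow walk walk-step (toℕ i) (λ k _ → cycle-avoids C (index k)) (proj₂ start))

-- Cycles in disjoint copies attached to one new vertex

copyOf : ∀ k n → Fin (k * n) → Fin k
copyOf k n = proj₁ ∘ remQuot {k} n

copies-adjacent⇒same-copy : ∀ k {n} (F : Graph n) x y → T (adj (copies k F) x y) →
  copyOf k n x ≡ copyOf k n y
copies-adjacent⇒same-copy k {n} F x y x~y with copyOf k n x ≟ copyOf k n y
-- For different copies the adjacency computes to `false`, which leaves no other case.
... | yes eq = eq

-- The whole cycle lies in one copy `c`, so its vertices are told apart by their positions within
-- that copy.
cycle-length≤copy-size : ∀ k {n} (F : Graph n) (N : Subset (k * n)) →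
  (∀ x y → x ∈ N → y ∈ N → copyOf k n x ≡ copyOf k n y → x ≡ y) →
  ∀ {ℓ} → Cycle (addVertex (copies k F) N) ℓ → ℓ ≤ n
cycle-length≤copy-size k {n} F N separates {ℓ} C with cycle-in-one-class C
  where open BridgeVertex (copies k F) N (copyOf k n) (copies-adjacent⇒same-copy k F) separates
... | c , in-class = injective⇒≤ position-injective
  where
  position : Fin ℓ → Fin n
  position i = proj₂ (remQuot {k} n (proj₁ (in-class i)))

  vertex≡ : ∀ i → Cycle.vertex C i ≡ suc (combine c (position i))
  vertex≡ i with in-class i
  ... | y , eq , refl = trans eq (cong suc (sym (combine-remQuot {k} n y)))

  position-injective : Injective _≡_ _≡_ position
  position-injective {i} {j} eq = Injection.injective (Cycle.vertices C)
    (trans (vertex≡ i) (trans (cong (suc ∘ combine c) eq) (sym (vertex≡ j))))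

-- An attachment vertex is determined by its copy, which is how `theGraph` meets the separation
-- hypothesis.
attachment : ∀ {n} (v : Fin 3 → Fin n) {x} →
  x ∈ (⁅ combine {3} 0F (v 0F) ⁆ ∪ ⁅ combine {3} 1F (v 1F) ⁆ ∪ ⁅ combine {3} 2F (v 2F) ⁆) →
  x ≡ combine (copyOf 3 n x) (v (copyOf 3 n x))
attachment {n} v {x} x∈ =
  [ in-own-copy 0F , [ in-own-copy 1F , in-own-copy 2F ]′ ∘ x∈p∪q⁻ _ _ ]′ (x∈p∪q⁻ _ _ x∈)
  where
  in-own-copy : ∀ i → x ∈ ⁅ combine i (v i) ⁆ →
    x ≡ combine (copyOf 3 n x) (v (copyOf 3 n x))
  in-own-copy i x∈⁅vᵢ⁆ with x∈⁅y⁆⇒x≡y _ x∈⁅vᵢ⁆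
  ... | refl = cong (λ j → combine j (v j)) (sym (cong proj₁ (remQuot-combine {3} i (v i))))

theGraph-cycle-length : ∀ v₁ v₂ v₃ {ℓ} → Cycle (theGraph v₁ v₂ v₃) ℓ → ℓ ≤ 4
theGraph-cycle-length v₁ v₂ v₃ = cycle-length≤copy-size 3 H _ λ x y x∈ y∈ same-copy →
  trans (attachment v x∈)
    (trans (cong (λ i → combine i (v i)) same-copy) (sym (attachment v y∈)))
  where
  v : Fin 3 → Fin 4
  v = lookup (v₁ ∷ v₂ ∷ v₃ ∷ [])

theGraph-no-long-odd-cycle : ∀ v₁ v₂ v₃ ℓ → ℓ % 2 ≡ 1 → 3 < ℓ → ¬ Cycle (theGraph v₁ v₂ v₃) ℓ
theGraph-no-long-odd-cycle v₁ v₂ v₃ ℓ odd 3<ℓ C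
  with ≤-antisym (theGraph-cycle-length v₁ v₂ v₃ C) 3<ℓ
-- Only length 4 remains, and `4 % 2` computes to 0.
theGraph-no-long-odd-cycle v₁ v₂ v₃ ℓ () 3<ℓ C | refl

-- Orientations of line graphs

-- Deleting `a` and then `b` from the out-neighbourhood still leaves `c`, and each deletion lowers
-- the cardinality.
three-outNeighbours⇒3≤outDegree : ∀ {n} (D : Digraph n) {x a b c} →
  T (arc D x a) → T (arc D x b) → T (arc D x c) →
  a ≢ b → a ≢ c → b ≢ c → 3 ≤ outDegree D x
three-outNeighbours⇒3≤outDegree D {x} {a} {b} {c} x→a x→b x→c a≢b a≢c b≢c =
  ≤-<-trans (≤-<-trans (≤-<-trans z≤n (drop c∈)) (drop b∈)) (drop (member x→a))
  where
  N = tabulate (arc D x)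
  drop : ∀ {n} {p : Subset n} {y} → y ∈ p → ∣ p - y ∣ < ∣ p ∣
  drop = x∈p⇒∣p-x∣<∣p∣
  member : ∀ {y} → T (arc D x y) → y ∈ N
  member {y} x→y =
    lookup⇒[]= y N (trans (lookup∘tabulate (arc D x) y) (Equivalence.to T-≡ x→y))
  b∈ : b ∈ (N - a)
  b∈ = x∈p∧x≢y⇒x∈p-y (member x→b) (≢-sym a≢b)
  c∈ : c ∈ ((N - a) - b)
  c∈ = x∈p∧x≢y⇒x∈p-y (x∈p∧x≢y⇒x∈p-y (member x→c) (≢-sym a≢c)) (≢-sym b≢c)

IsEmbedding : ∀ {m n} → Graph m → Graph n → (Fin m → Fin n) → Set
IsEmbedding P L f =
  (∀ a b → f a ≡ f b → a ≡ b) × (∀ a b → T (adj P a b) → T (adj L (f a) (f b)))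

isEmbedding? : ∀ {m n} (P : Graph m) (L : Graph n) f → Dec (IsEmbedding P L f)
isEmbedding? P L f =
  all? (λ a → all? λ b → f a ≟ f b →-dec a ≟ b)
  ×-dec all? (λ a → all? λ b → T? (adj P a b) →-dec T? (adj L (f a) (f b)))

record Embedding {m n} (P : Graph m) (L : Graph n) : Set where
  field
    map         : Fin m → Fin n
    isEmbedding : IsEmbedding P L map

  injective : ∀ a b → map a ≡ map b → a ≡ b
  injective = proj₁ isEmbedding

  preserves : ∀ a b → T (adj P a b) → T (adj L (map a) (map b))
  preserves = proj₂ isEmbedding

open Embedding

_∘ᴱ_ : ∀ {l m n} {P : Graph l} {Q : Graph m} {L : Graph n} →
  Embedding Q L → Embedding P Q → Embedding P L
f ∘ᴱ g = record
  { map         = map f ∘ map g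
  ; isEmbedding = (λ a b → injective g a b ∘ injective f _ _)
                , (λ a b → preserves f _ _ ∘ preserves g a b)
  }

embedding : ∀ {m n} (P : Graph m) (L : Graph n) (f : Fin m → Fin n) →
  {True (isEmbedding? P L f)} → Embedding P L
embedding P L f {check} = record { map = f ; isEmbedding = toWitness check }

-- A kernel of an orientation of a clique is a single vertex.
clique-sink : ∀ {m n} {L : Graph n} {D : Digraph n} →
  IsOrientation D L → KernelPerfect D → (e : Embedding (complete (suc m)) L) →
  ∃ λ s → ∀ j → j ≢ s → T (arc D (map e j) (map e s))
clique-sink {m} {L = L} {D} orient kp e with kp (mk↣ (λ {x} {y} → injective e x y))
... | S , kernel = proj₁ member , sink
  where
  open IsKernel kernel

  unique : ∀ {i j} → i ∈ S → j ∈ S → i ≡ j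
  unique {i} {j} i∈S j∈S with i ≟ j in eq
  ... | yes i≡j = i≡j
  ... | no  i≢j with IsOrientation.edge⇒arc orient _ _ (preserves e i j i~j)
    where
    i~j : T (adj (complete (suc m)) i j)
    i~j rewrite eq = _
  ...   | inj₁ i→j = contradiction i→j (independent i j i∈S j∈S)
  ...   | inj₂ j→i = contradiction j→i (independent j i j∈S i∈S)

  member : ∃ λ s → s ∈ S
  member with 0F ∈? S
  ... | yes 0∈S = 0F , 0∈S
  ... | no  0∉S with absorbing 0F 0∉S
  ...   | y , y∈S , _ = y , y∈S

  sink : ∀ j → j ≢ proj₁ member → T (arc D (map e j) (map e (proj₁ member)))
  sink j j≢s with absorbing j (λ j∈S → j≢s (unique j∈S (proj₂ member)))
  ... | y , y∈S , j→y rewrite unique (proj₂ member) y∈S = j→y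

-- The gadget: one copy of `H` with a pendant edge at its chosen vertex

pendantDiamond : Graph 5
pendantDiamond = addVertex H ⁅ 2F ⁆

-- The edges of `pendantDiamond` in the order of `edges`: u is the pendant vertex,
-- v its neighbour, p and q the vertices of degree 3, w the other one.
pattern uv = 0F
pattern pq = 1F
pattern pv = 2F
pattern pw = 3F
pattern qv = 4F
pattern qw = 5F

-- The symmetry of the gadget that exchanges p and q; it reduces an arc from `qv` to `pv` to the
-- opposite case.
swap-pq : Embedding (lineGraph pendantDiamond) (lineGraph pendantDiamond)
swap-pq = embedding _ _ (lookup (uv ∷ pq ∷ qv ∷ qw ∷ pv ∷ pw ∷ []))

module _ {n} {L : Graph n} {D : Digraph n} (orient : IsOrientation D L)
  (kp : KernelPerfect D) (outDegree<3 : ∀ e → outDegree D e < 3) where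

  infix 4 _⟶_
  _⟶_ : Fin n → Fin n → Set
  x ⟶ y = T (arc D x y)

  no-third-arc : ∀ {x a b c} → x ⟶ a → x ⟶ b → a ≢ b → a ≢ c → b ≢ c → ¬ x ⟶ c
  no-third-arc x→a x→b a≢b a≢c b≢c x→c =
    <⇒≱ (outDegree<3 _) (three-outNeighbours⇒3≤outDegree D x→a x→b x→c a≢b a≢c b≢c)

  reverse-arc : ∀ {x y} → T (adj L x y) → ¬ x ⟶ y → y ⟶ x
  reverse-arc x~y ¬x→y with IsOrientation.edge⇒arc orient _ _ x~y
  ... | inj₁ x→y = contradiction x→y ¬x→y
  ... | inj₂ y→x = y→x

  -- Of the two vertices other than the sink, one has an arc to the other.
  triangle-source : (e : Embedding (complete 3) L) →
    ∃ λ i → ∃ λ j → ∃ λ k → j ≢ k × map e i ⟶ map e j × map e i ⟶ map e k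
  triangle-source e with clique-sink orient kp e
  ... | s , →s with IsOrientation.edge⇒arc orient _ _ (preserves e _ _ (others-adjacent s))
    where
    others-adjacent : ∀ (s : Fin 3) → T (adj (complete 3) (punchIn s 0F) (punchIn s 1F))
    others-adjacent 0F = _
    others-adjacent 1F = _
    others-adjacent 2F = _
  ... | inj₁ a→b = _ , punchIn s 1F , s , punchInᵢ≢i s 1F , a→b , →s _ (punchInᵢ≢i s 0F)
  ... | inj₂ b→a = _ , punchIn s 0F , s , punchInᵢ≢i s 0F , b→a , →s _ (punchInᵢ≢i s 1F)

  module Gadget (e : Embedding (lineGraph pendantDiamond) L)
    (¬uv→pv : ¬ map e uv ⟶ map e pv) (¬uv→qv : ¬ map e uv ⟶ map e qv) where

    infix 4 _⇒_
    _⇒_ : Fin 6 → Fin 6 → Set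
    a ⇒ b = map e a ⟶ map e b

    -- Two known arcs exhaust the out-degree of `x`. Alternating this with `back` propagates forced
    -- arcs through the gadget.
    full : ∀ {x a b} → x ⇒ a → x ⇒ b → ∀ c →
      {False (a ≟ b)} → {False (a ≟ c)} → {False (b ≟ c)} → ¬ x ⇒ c
    full x→a x→b c {a≢b} {a≢c} {b≢c} =
      no-third-arc x→a x→b (lift a≢b) (lift a≢c) (lift b≢c)
      where
      lift : ∀ {a b} → False (a ≟ b) → map e a ≢ map e b
      lift a≢b eq = toWitnessFalse a≢b (injective e _ _ eq)

    back : ∀ x y → {T (adj (lineGraph pendantDiamond) x y)} → ¬ x ⇒ y → y ⇒ x
    back x y {x~y} = reverse-arc (preserves e x y x~y)

    triangle : ∀ x y z →
      {True (isEmbedding? (complete 3) (lineGraph pendantDiamond) (lookup (x ∷ y ∷ z ∷ [])))} →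
      Embedding (complete 3) L
    triangle x y z {check} = e ∘ᴱ embedding (complete 3) _ _ {check}

    pv→uv : pv ⇒ uv
    pv→uv = back uv pv ¬uv→pv

    qv→uv : qv ⇒ uv
    qv→uv = back uv qv ¬uv→qv

    -- The five edges of the copy have eight arcs left for their eight adjacencies, since `pv` and
    -- `qv` each spend one on `uv`; a double arc would require a ninth. The forced arcs make the
    -- excess appear at `qw`.
    ¬pv⇄qv : pv ⇒ qv → ¬ qv ⇒ pv
    ¬pv⇄qv pv→qv qv→pv = full qw→qv qw→pq pw qw→pw
      where
      pq→pv : pq ⇒ pv
      pq→pv = back pv pq (full pv→uv pv→qv pq)
      pq→qv : pq ⇒ qv
      pq→qv = back qv pq (full qv→uv qv→pv pq)
      pw→pv : pw ⇒ pv
      pw→pv = back pv pw (full pv→uv pv→qv pw)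
      qw→qv : qw ⇒ qv
      qw→qv = back qv qw (full qv→uv qv→pv qw)
      pw→pq : pw ⇒ pq
      pw→pq = back pq pw (full pq→pv pq→qv pw)
      qw→pq : qw ⇒ pq
      qw→pq = back pq qw (full pq→pv pq→qv qw)
      qw→pw : qw ⇒ pw
      qw→pw = back pw qw (full pw→pv pw→pq qw)

    -- In the triangle `pq`, `pv`, `qv` only `qv` can be the sink: `pv` has no arc left for `pq`,
    -- and `qv ⇒ pv` would give a double arc. The arcs forced by this turn `pq`, `qv`, `qw` into a
    -- directed triangle with no reverse arcs, hence without a sink.
    ¬pv→qv : ¬ pv ⇒ qv
    ¬pv→qv pv→qv with clique-sink orient kp (triangle pq pv qv)
    ... | 0F , →pq = full pv→uv pv→qv pq (→pq 1F λ ())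
    ... | 1F , →pv = ¬pv⇄qv pv→qv (→pv 2F λ ())
    ... | 2F , →qv = no-sink (clique-sink orient kp (triangle pq qv qw))
      where
      pq→pv : pq ⇒ pv
      pq→pv = back pv pq (full pv→uv pv→qv pq)
      pq→qv : pq ⇒ qv
      pq→qv = →qv 0F λ ()
      pw→pv : pw ⇒ pv
      pw→pv = back pv pw (full pv→uv pv→qv pw)
      pw→pq : pw ⇒ pq
      pw→pq = back pq pw (full pq→pv pq→qv pw)
      qw→pq : qw ⇒ pq
      qw→pq = back pq qw (full pq→pv pq→qv qw)
      qw→pw : qw ⇒ pw
      qw→pw = back pw qw (full pw→pv pw→pq qw)
      qv→qw : qv ⇒ qw
      qv→qw = back qw qv (full qw→pq qw→pw qv)
      no-sink : ¬ ∃ λ s → ∀ j → j ≢ s → map (triangle pq qv qw) j ⟶ map (triangle pq qv qw) s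
      no-sink (0F , →pq) = full qv→uv qv→qw pq (→pq 1F λ ())
      no-sink (1F , →qv) = full qw→pq qw→pw qv (→qv 2F λ ())
      no-sink (2F , →qw) = full pq→pv pq→qv qw (→qw 0F λ ())

  pendant-edge-has-arc : (e : Embedding (lineGraph pendantDiamond) L) →
    ¬ map e uv ⟶ map e pv → ¬ ¬ map e uv ⟶ map e qv
  pendant-edge-has-arc e ¬uv→pv ¬uv→qv
    with IsOrientation.edge⇒arc orient _ _ (preserves e pv qv _)
  ... | inj₁ pv→qv = Gadget.¬pv→qv e ¬uv→pv ¬uv→qv pv→qv
  ... | inj₂ qv→pv = Gadget.¬pv→qv (e ∘ᴱ swap-pq) ¬uv→qv ¬uv→pv qv→pv

  -- Some pendant edge spends both its arcs on the other two pendant edges. By `apart` these are not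
  -- edges of its own copy, so it has none left for `pv` and `qv`.
  no-joined-gadgets : (f : Fin 3 → Fin 6 → Fin n) →
    IsEmbedding (complete 3) L (λ i → f i uv) →
    (∀ i → IsEmbedding (lineGraph pendantDiamond) L (f i)) →
    ¬ (∀ i j a → f i (suc a) ≢ f j uv)
  no-joined-gadgets f hub gadget apart
    with triangle-source (record { isEmbedding = hub })
  ... | i , j , k , j≢k , i→j , i→k =
    -- `suc 1F` is `pv` and `suc 3F` is `qv`.
    pendant-edge-has-arc (record { isEmbedding = gadget i }) (saturated 1F) (saturated 3F)
    where
    saturated : ∀ a → ¬ f i uv ⟶ f i (suc a)
    saturated a = no-third-arc i→j i→k
      (j≢k ∘ proj₁ hub j k) (≢-sym (apart i j a)) (≢-sym (apart i k a))

-- For a concrete `G` and `f`, the implicit `True` arguments are settled by evaluating the decision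
-- procedures.
not-3-edge-orientable : ∀ {n} (G : Graph n) (f : Fin 3 → Fin 6 → Fin (length (edges G))) →
  {True (isEmbedding? (complete 3) (lineGraph G) (λ i → f i uv))} →
  {True (all? λ i → isEmbedding? (lineGraph pendantDiamond) (lineGraph G) (f i))} →
  {True (all? λ i → all? λ j → all? λ a → ¬? (f i (suc a) ≟ f j uv))} →
  ¬ EdgeOrientable 3 G
not-3-edge-orientable G f {hub} {gadget} {apart} (_ , orient , kp , outDegree<3) =
  no-joined-gadgets orient kp outDegree<3 f
    (toWitness hub) (toWitness gadget) (toWitness apart)

-- `edges (theGraph v₁ v₂ v₃)` lists the three edges at u, then the five edges of each
-- copy of H in the order pq, pv, pw, qv, qw if v = 2, and pq, pw, pv, qw, qv if v = 3.
edgePosition : (v : Fin 4) → Fin 3 → Fin 6 → Fin (3 + 3 * 5)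
edgePosition v i zero    = i ↑ˡ (3 * 5)
edgePosition v i (suc a) = 3 ↑ʳ combine i (order v a)
  where
  order : Fin 4 → Fin 5 → Fin 5
  order 3F = lookup (0F ∷ 2F ∷ 1F ∷ 4F ∷ 3F ∷ [])
  order _  = λ a → a

edgePositions : (v₁ v₂ v₃ : Fin 4) → Fin 3 → Fin 6 → Fin (3 + 3 * 5)
edgePositions v₁ v₂ v₃ i = edgePosition (lookup (v₁ ∷ v₂ ∷ v₃ ∷ []) i) i

-- Reduction to eight concrete graphs

degree-2-cases : {P : Fin 4 → Set} → P 2F → P 3F → ∀ v → degree H v ≡ 2 → P v
degree-2-cases _  _  0F ()
degree-2-cases _  _  1F ()
degree-2-cases p₂ _  2F _ = p₂
degree-2-cases _  p₃ 3F _ = p₃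

-- Each chosen vertex is `2F` or `3F`. Treating the eight triples separately makes every graph
-- closed, so that its degrees and edge list compute.
for-all-choices : {P : Fin 4 → Fin 4 → Fin 4 → Set} →
  P 2F 2F 2F → P 2F 2F 3F → P 2F 3F 2F → P 2F 3F 3F →
  P 3F 2F 2F → P 3F 2F 3F → P 3F 3F 2F → P 3F 3F 3F →
  ∀ v₁ v₂ v₃ → degree H v₁ ≡ 2 → degree H v₂ ≡ 2 → degree H v₃ ≡ 2 → P v₁ v₂ v₃
for-all-choices {P} p₂₂₂ p₂₂₃ p₂₃₂ p₂₃₃ p₃₂₂ p₃₂₃ p₃₃₂ p₃₃₃ v₁ v₂ v₃ d₁ d₂ d₃ =
  degree-2-cases {λ v₁ → P v₁ v₂ v₃}
    (degree-2-cases {λ v₂ → P 2F v₂ v₃}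
      (degree-2-cases {P 2F 2F} p₂₂₂ p₂₂₃ v₃ d₃)
      (degree-2-cases {P 2F 3F} p₂₃₂ p₂₃₃ v₃ d₃) v₂ d₂)
    (degree-2-cases {λ v₂ → P 3F v₂ v₃}
      (degree-2-cases {P 3F 2F} p₃₂₂ p₃₂₃ v₃ d₃)
      (degree-2-cases {P 3F 3F} p₃₃₂ p₃₃₃ v₃ d₃) v₂ d₂) v₁ d₁

theGraph-maxDegree : ∀ v₁ v₂ v₃ → degree H v₁ ≡ 2 → degree H v₂ ≡ 2 → degree H v₃ ≡ 2 →
  maxDegree (theGraph v₁ v₂ v₃) ≡ 3
theGraph-maxDegree = for-all-choices {λ v₁ v₂ v₃ → maxDegree (theGraph v₁ v₂ v₃) ≡ 3}
  refl refl refl refl refl refl refl refl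

theGraph-not-3-edge-orientable : ∀ v₁ v₂ v₃ →
  degree H v₁ ≡ 2 → degree H v₂ ≡ 2 → degree H v₃ ≡ 2 →
  ¬ EdgeOrientable 3 (theGraph v₁ v₂ v₃)
theGraph-not-3-edge-orientable = for-all-choices
  {λ v₁ v₂ v₃ → ¬ EdgeOrientable 3 (theGraph v₁ v₂ v₃)}
  (not-3-edge-orientable (theGraph 2F 2F 2F) (edgePositions 2F 2F 2F))
  (not-3-edge-orientable (theGraph 2F 2F 3F) (edgePositions 2F 2F 3F))
  (not-3-edge-orientable (theGraph 2F 3F 2F) (edgePositions 2F 3F 2F))
  (not-3-edge-orientable (theGraph 2F 3F 3F) (edgePositions 2F 3F 3F))
  (not-3-edge-orientable (theGraph 3F 2F 2F) (edgePositions 3F 2F 2F))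
  (not-3-edge-orientable (theGraph 3F 2F 3F) (edgePositions 3F 2F 3F))
  (not-3-edge-orientable (theGraph 3F 3F 2F) (edgePositions 3F 3F 2F))
  (not-3-edge-orientable (theGraph 3F 3F 3F) (edgePositions 3F 3F 3F))

mainTheorem20 : (v₁ v₂ v₃ : Fin 4) →
    degree H v₁ ≡ 2 → degree H v₂ ≡ 2 → degree H v₃ ≡ 2 →
    maxDegree (theGraph v₁ v₂ v₃) ≡ 3
    × (∀ (ℓ : ℕ) → ℓ % 2 ≡ 1 → 3 < ℓ → ¬ Cycle (theGraph v₁ v₂ v₃) ℓ)
    × ¬ EdgeOrientable 3 (theGraph v₁ v₂ v₃)
mainTheorem20 v₁ v₂ v₃ d₁ d₂ d₃ =
    theGraph-maxDegree v₁ v₂ v₃ d₁ d₂ d₃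
  , theGraph-no-long-odd-cycle v₁ v₂ v₃
  , theGraph-not-3-edge-orientable v₁ v₂ v₃ d₁ d₂ d₃
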